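{- Let $B$ be a prime non-orientable bouquet. Then ${}^{\partial}\varepsilon_{B}(z)=2^{e(B)}z^{b}$ for some integer $b\ge 0$ if and only if $B=B_{\overline{1}}$, the bouquet with exactly one edge, that edge being a twisted loop (signed rotation $(1,-1)$).
   Context: Ribbon graphs are finite, possibly non-orientable, considered up to equivalence. For a ribbon graph $G$, let $v(G),e(G),f(G)$ be its numbers of vertices, edges and boundary components. For connected $G$ the Euler genus $\varepsilon(G)$ is defined by $2-\varepsilon(G)=v(G)-e(G)+f(G)$. For $A\subseteq E(G)$ the partial dual $G^{A}$ is obtained as follows: take the spanning ribbon subgraph $(V(G),A)$, glue a disc to $G$ along each boundary component of this subgraph (these discs are the vertex-discs of $G^A$), and remove the interiors of all vertex-discs of $G$; the edge-ribbons are kept as the edges of $G^A$. The partial-dual Euler genus polynomial of $G$ is ${}^{\partial}\varepsilon_{G}(z)=\sum_{A\subseteq E(G)}z^{\varepsilon(G^{A})}$. A bouquet is a ribbon graph with exactly one vertex. A loop $e$ at the vertex-disc $v$ is twisted if $e\cup v$ is homeomorphic to a Möbius band, and untwisted otherwise. A bouquet is non-orientable if and only if it has at least one twisted loop. The intersection graph $I(B)$ of a bouquet $B$ is the graph with vertex set $E(B)$ in which distinct $e$ and $f$ are adjacent if and only if their ends are met in the cyclic order $e\cdots f\cdots e\cdots f\cdots$ when travelling around the boundary of the unique vertex of $B$. A bouquet is prime if its intersection graph is connected. -}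

module Defs where

open import Data.Bool.Base using (Bool; true; false; not; if_then_else_)
import Data.Bool.Properties as Bool
open import Data.Fin.Base using (Fin)
import Data.Fin.Properties as Fin
open import Data.Fin.Subset using (Subset; inside; outside)
open import Data.Integer.Base as ℤ using (ℤ; +_)
import Data.Integer.Properties as ℤ
open import Data.List.Base
  using (List; []; _∷_; _++_; map; length; deduplicate; allFin; cartesianProduct)
open import Data.List.Membership.Propositional using (_∈_)
open import Data.List.Membership.Propositional.Properties
  using (∈-allFin; ∈-cartesianProduct⁺; ∈-map⁺; ∈-map⁻; ∈-++⁺ˡ; ∈-++⁺ʳ; ∈-++⁻)
open import Data.List.Relation.Unary.Any using (here; there)
open import Data.Nat.Base using (ℕ; _+_; _<_; _≤_)
open import Data.Nat.GeneralisedArithmetic using (iterate)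
open import Data.Nat.ListAction using (sum)
open import Data.Product.Base using (_×_; _,_; proj₁; ∃-syntax)
open import Data.Product.Properties using (≡-dec)
open import Data.Sum.Base using (_⊎_; inj₁; inj₂; [_,_]′)
open import Data.Vec.Base as Vec using (lookup)
open import Function.Base using (_∘_)
open import Function.Bundles using (_↔_; Inverse)
open import Level using (0ℓ)
open import Relation.Binary.Construct.Closure.Equivalence as Eq using (EqClosure)
open import Relation.Binary.Construct.Closure.ReflexiveTransitive using (Star; ε; _◅_; _◅◅_)
open import Relation.Binary.Construct.Closure.Symmetric using (fwd; bwd)
open import Relation.Binary.Core using (Rel)
open import Relation.Binary.Definitions using (Decidable; DecidableEquality)
open import Relation.Binary.PropositionalEquality
  using (_≡_; _≢_; refl; sym; trans; cong; subst)
open import Relation.Nullary.Decidable using (map′; yes; no; ⌊_⌋)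
open import Relation.Nullary.Negation using (contradiction)

-- A flag is a corner of an edge-ribbon.  The ribbon is a rectangle; its
-- corner (e , h , s) lies on the end h, one of the two opposite arcs along
-- which the ribbon is attached to vertex-discs, and on the side s, one of
-- the two other arcs.

Flag : ℕ → Set
Flag n = Fin n × Bool × Bool

edge : ∀ {n} → Flag n → Fin n
edge = proj₁

-- Travel along a side of the ribbon, to its other end.
τ₀ : ∀ {n} → Flag n → Flag n
τ₀ (e , h , s) = e , not h , s

-- Travel across an end of the ribbon, to its other side.
τ₂ : ∀ {n} → Flag n → Flag n
τ₂ (e , h , s) = e , h , not s

_≟ᶠ_ : ∀ {n} → DecidableEquality (Flag n)
_≟ᶠ_ = ≡-dec Fin._≟_ (≡-dec Bool._≟_ Bool._≟_)

flags : ∀ n → List (Flag n)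
flags n = cartesianProduct (allFin n) (cartesianProduct bools bools)
  where bools = false ∷ true ∷ []

∈-flags : ∀ {n} (x : Flag n) → x ∈ flags n
∈-flags (e , h , s) =
  ∈-cartesianProduct⁺ (∈-allFin e) (∈-cartesianProduct⁺ (∈-bools h) (∈-bools s))
  where
  ∈-bools : ∀ b → b ∈ false ∷ true ∷ []
  ∈-bools false = here refl
  ∈-bools true  = there (here refl)

module Gluing {A : Set} (_≟_ : DecidableEquality A) where

  Glued : List (A × A) → Rel A 0ℓ
  Glued ps = EqClosure (λ x y → (x , y) ∈ ps)

  relabel : A → A → A → A
  relabel a b x with x ≟ b
  ... | yes _ = a
  ... | no  _ = x

  representative : List (A × A) → A → A
  representative []             x = x
  representative ((a , b) ∷ ps) x =
    relabel (representative ps a) (representative ps b) (representative ps x)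

  private
    weaken : ∀ {p ps x y} → Glued ps x y → Glued (p ∷ ps) x y
    weaken = Eq.map there

  x∼representative : ∀ ps x → Glued ps x (representative ps x)
  x∼representative []             x = ε
  x∼representative ((a , b) ∷ ps) x with representative ps x ≟ representative ps b
  ... | no  _   = weaken (x∼representative ps x)
  ... | yes x≡b =
    weaken (subst (Glued ps x) x≡b (x∼representative ps x))
    ◅◅ weaken (Eq.symmetric _ (x∼representative ps b))
    ◅◅ bwd (here refl) ◅ weaken (x∼representative ps a)

  relabel-glues : ∀ a b → relabel a b a ≡ relabel a b b
  relabel-glues a b with a ≟ b | b ≟ b
  ... | yes _ | yes _  = refl
  ... | no  _ | yes _  = refl
  ... | _     | no b≢b = contradiction refl b≢b

  representative-step : ∀ ps {x y} → (x , y) ∈ ps → representative ps x ≡ representative ps y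
  representative-step ((a , b) ∷ ps) (here refl)   = relabel-glues _ _
  representative-step ((a , b) ∷ ps) (there xy∈ps) =
    cong (relabel _ _) (representative-step ps xy∈ps)

  representative-cong : ∀ ps {x y} → Glued ps x y → representative ps x ≡ representative ps y
  representative-cong ps ε             = refl
  representative-cong ps (fwd xz ◅ zy) =
    trans (representative-step ps xz) (representative-cong ps zy)
  representative-cong ps (bwd zx ◅ zy) =
    trans (sym (representative-step ps zx)) (representative-cong ps zy)

  glued? : ∀ ps → Decidable (Glued ps)
  glued? ps x y = map′
    (λ eq → x∼representative ps x
            ◅◅ subst (λ z → Glued ps z y) (sym eq) (Eq.symmetric _ (x∼representative ps y)))
    (representative-cong ps)
    (representative ps x ≟ representative ps y)

SameOrbit : ∀ {n} (σ τ : Flag n → Flag n) → Rel (Flag n) 0ℓ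
SameOrbit σ τ = EqClosure (λ x y → σ x ≡ y ⊎ τ x ≡ y)

sameOrbit? : ∀ {n} (σ τ : Flag n → Flag n) → Decidable (SameOrbit σ τ)
sameOrbit? {n} σ τ x y = map′ (Eq.map from) (Eq.map to) (glued? pairs x y)
  where
  open Gluing _≟ᶠ_

  graph : (Flag n → Flag n) → List (Flag n × Flag n)
  graph f = map (λ x → x , f x) (flags n)

  pairs : List (Flag n × Flag n)
  pairs = graph σ ++ graph τ

  ∈-graph⁺ : ∀ f {x y} → f x ≡ y → (x , y) ∈ graph f
  ∈-graph⁺ f {x} refl = ∈-map⁺ _ (∈-flags x)

  ∈-graph⁻ : ∀ f {x y} → (x , y) ∈ graph f → f x ≡ y
  ∈-graph⁻ f xy∈ with _ , _ , refl ← ∈-map⁻ (λ x → x , f x) xy∈ = refl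

  from : ∀ {x y} → (x , y) ∈ pairs → σ x ≡ y ⊎ τ x ≡ y
  from xy∈ with ∈-++⁻ (graph σ) xy∈
  ... | inj₁ xy∈σ = inj₁ (∈-graph⁻ σ xy∈σ)
  ... | inj₂ xy∈τ = inj₂ (∈-graph⁻ τ xy∈τ)

  to : ∀ {x y} → σ x ≡ y ⊎ τ x ≡ y → (x , y) ∈ pairs
  to = [ ∈-++⁺ˡ ∘ ∈-graph⁺ σ , ∈-++⁺ʳ (graph σ) ∘ ∈-graph⁺ τ ]′

#orbits : ∀ {n} (σ τ : Flag n → Flag n) → ℕ
#orbits {n} σ τ = length (deduplicate (sameOrbit? σ τ) (flags n))

-- The boundary circle of a vertex-disc that meets some edge alternates
-- between ends of ribbons (traversed by τ₂) and free arcs between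
-- consecutive ends (traversed by τ₁).  Conversely, ends and free arcs fit
-- together into circles, which are filled with discs; so τ₁ determines all
-- vertex-discs but those without edges, which have to be counted apart.

record RibbonGraph : Set where
  field
    |E|               : ℕ
    #isolatedVertices : ℕ
    τ₁                : Flag |E| → Flag |E|
    τ₁-involutive     : ∀ x → τ₁ (τ₁ x) ≡ x
    τ₁-fixedPointFree : ∀ x → τ₁ x ≢ x

  |V| : ℕ
  |V| = #isolatedVertices + #orbits τ₁ τ₂

  -- Boundary components follow free arcs and sides of ribbons; the boundary
  -- of an isolated vertex-disc is a further one.
  |F| : ℕ
  |F| = #isolatedVertices + #orbits τ₀ τ₁

  -- 2 - ε(G) = v(G) - e(G) + f(G), for connected G.
  eulerGenus : ℤ
  eulerGenus = + 2 ℤ.- (+ |V| ℤ.- + |E| ℤ.+ + |F|)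

  -- One step around the boundary of a vertex-disc, from the start of an end
  -- of a ribbon to the start of the next.  A flag has two travel directions;
  -- ρ first crosses the end the flag lies on.
  ρ : Flag |E| → Flag |E|
  ρ x = τ₁ (τ₂ x)

open RibbonGraph public

-- Equivalence of ribbon graphs; orientations need not be preserved.
infix 4 _≅_

record _≅_ (G H : RibbonGraph) : Set where
  field
    bijection : Flag (|E| G) ↔ Flag (|E| H)
  open Inverse bijection using (to)
  field
    to-τ₀    : ∀ x → to (τ₀ x) ≡ τ₀ (to x)
    to-τ₁    : ∀ x → to (τ₁ G x) ≡ τ₁ H (to x)
    to-τ₂    : ∀ x → to (τ₂ x) ≡ τ₂ (to x)
    isolated : #isolatedVertices G ≡ #isolatedVertices H

-- The boundary of (V(G) , A) follows the free arcs of G, the sides of the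
-- ribbons in A and the ends of the ribbons not in A.  These curves bound the
-- new vertex-discs, so the ribbons in A are now attached along their former
-- sides: ends and sides of these ribbons exchange their rôles, and free arcs
-- remain free arcs.

exchange : ∀ {n} → Subset n → Flag n → Flag n
exchange A (e , h , s) = if lookup A e then (e , s , h) else (e , h , s)

exchange-involutive : ∀ {n} (A : Subset n) x → exchange A (exchange A x) ≡ x
exchange-involutive A (e , h , s) with lookup A e in eq
... | true  rewrite eq = refl
... | false rewrite eq = refl

partialDual : (G : RibbonGraph) → Subset (|E| G) → RibbonGraph
partialDual G A = record
  { |E|               = |E| G
  ; #isolatedVertices = #isolatedVertices G
  ; τ₁                = λ x → exchange A (τ₁ G (exchange A x))
  ; τ₁-involutive     = λ x →
      trans (cong (exchange A ∘ τ₁ G) (exchange-involutive A _))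
      (trans (cong (exchange A) (τ₁-involutive G _)) (exchange-involutive A x))
  ; τ₁-fixedPointFree = λ x eq →
      τ₁-fixedPointFree G (exchange A x)
        (trans (sym (exchange-involutive A _)) (cong (exchange A) eq))
  }

-- Laurent polynomials in z, as coefficient functions.  Negative exponents are
-- admitted because eulerGenus takes values in ℤ.
LaurentPolynomial : Set
LaurentPolynomial = ℤ → ℕ

infix 7 _·z^_

_·z^_ : ℕ → ℤ → LaurentPolynomial
(c ·z^ k) i = if ⌊ i ℤ.≟ k ⌋ then c else 0

∑ : List LaurentPolynomial → LaurentPolynomial
∑ ps i = sum (map (λ p → p i) ps)

subsets : ∀ n → List (Subset n)
subsets ℕ.zero    = Vec.[] ∷ []
subsets (ℕ.suc n) = map (outside Vec.∷_) (subsets n) ++ map (inside Vec.∷_) (subsets n)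

∂ε : RibbonGraph → LaurentPolynomial
∂ε G = ∑ (map (λ A → 1 ·z^ eulerGenus (partialDual G A)) (subsets (|E| G)))

IsBouquet : RibbonGraph → Set
IsBouquet B = |V| B ≡ 1

-- Travel once around v in a fixed direction.  The loop e is twisted when its
-- two ends are crossed in the same direction, i.e. starting on the same side
-- of the ribbon: transport along e then reverses the orientation of v, and
-- e ∪ v is a Möbius band.  Otherwise e ∪ v is an annulus.
IsTwisted : (B : RibbonGraph) → Fin (|E| B) → Set
IsTwisted B e = ∃[ k ] iterate (ρ B) x k ≡ τ₀ x
  where x = e , false , false

IsNonOrientable : RibbonGraph → Set
IsNonOrientable B = ∃[ e ] IsTwisted B e

-- The ends of e and f are met in the cyclic order e ⋯ f ⋯ e ⋯ f ⋯ at steps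
-- 0 < i < j < k of a single turn around the vertex, which meets each end of
-- a ribbon once.
Interlaced : (B : RibbonGraph) → Rel (Fin (|E| B)) 0ℓ
Interlaced B e f = ∃[ x ] ∃[ i ] ∃[ j ] ∃[ k ]
    (0 < i × i < j × j < k)
  × (∀ l → 0 < l → l ≤ k → iterate (ρ B) x l ≢ x)
  × edge x ≡ e
  × edge (iterate (ρ B) x i) ≡ f
  × edge (iterate (ρ B) x j) ≡ e
  × edge (iterate (ρ B) x k) ≡ f

IntersectionGraph : (B : RibbonGraph) → Rel (Fin (|E| B)) 0ℓ
IntersectionGraph B e f = e ≢ f × Interlaced B e f

IsConnected : ∀ {n} → Rel (Fin n) 0ℓ → Set
IsConnected _~_ = ∀ u v → EqClosure _~_ u v

IsPrime : RibbonGraph → Set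
IsPrime B = IsConnected (IntersectionGraph B)

-- The bouquet with signed rotation (1 , -1).
B₁̄ : RibbonGraph
B₁̄ = record
  { |E|               = 1
  ; #isolatedVertices = 0
  ; τ₁                = λ (e , h , s) → e , not h , not s
  ; τ₁-involutive     = λ where
      (e , false , false) → refl
      (e , false , true)  → refl
      (e , true  , false) → refl
      (e , true  , true)  → refl
  ; τ₁-fixedPointFree = λ where
      (e , false , s) ()
      (e , true  , s) ()
  }

{-# OPTIONS --safe #-}

-- Since V(B^A) = F(A) and F(B^A) = F(E ∖ A), where F counts the boundary components
-- of a spanning ribbon subgraph, ∂ε is a monomial iff F(A) + F(E ∖ A) is constant.
-- Besides being absent or present, a ribbon may be crossed, joining its diagonally
-- opposite corners.  The rest of the surface joins the four corners in one of the
-- same three ways; hence two of the three states of a ribbon give equally many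
-- boundary components, and the third gives one more.
--
-- Let the twisted loop e be interlaced with f.  Then F(∅) = F(e) = 1, and F(f), F(ef)
-- are 1 and 2 in some order.  By constancy, there is k such that F(E) = F(E ∖ e) = k + 1,
-- while F(E ∖ f) and F(E ∖ ef) are k and k + 1 in some order.  So crossing e gives k + 2
-- components in the presence of f and k in its absence, although adding f changes the
-- number of components by at most 1.

module Submission where

open import Defs
open import Data.Bool.Base using (Bool; true; false; not; _xor_; if_then_else_)
import Data.Bool.Properties as Bool
open import Data.Empty using (⊥; ⊥-elim)
open import Data.Fin.Base as Fin using (Fin; toℕ)
import Data.Fin.Properties as Fin
open import Data.Fin.Subset using (Subset)
open import Data.Integer.Base as ℤ using (ℤ; +_)
import Data.Integer.Properties as ℤ
import Data.Integer.Tactic.RingSolver as ℤ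
open import Algebra.Properties.AbelianGroup ℤ.+-0-abelianGroup using (∙-cancelˡ)
open import Data.List.Base using (List; []; _∷_; _++_; length; filter; lookup; map; deduplicate)
open import Data.List.Membership.Propositional using (_∈_)
open import Data.List.Membership.Propositional.Properties using (∈-lookup; ∈-map⁺; ∈-++⁺ˡ; ∈-++⁺ʳ)
open import Data.List.Properties using (map-∘; length-map; length-++)
open import Data.List.Relation.Unary.All as All using (All; []; _∷_)
open import Data.List.Relation.Unary.All.Properties using (all-filter)
open import Data.List.Relation.Unary.AllPairs as AllPairs using (AllPairs; []; _∷_)
import Data.List.Relation.Unary.AllPairs.Properties as AllPairs
open import Data.List.Relation.Unary.Any as Any using (Any; here; there; index)
import Data.List.Relation.Unary.Any.Properties as Any
open import Data.List.Relation.Unary.Unique.DecSetoid.Properties using (deduplicate-!)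
open import Data.Nat.Base
open import Data.Nat.GeneralisedArithmetic using (iterate)
open import Data.Nat.Induction using (<-rec)
open import Data.Nat.ListAction using (sum)
open import Data.Nat.Properties
open import Data.Product.Base as Product using (_×_; _,_; proj₁; proj₂; ∃-syntax)
open import Data.Product.Properties using (≡-dec)
open import Data.Sum.Base as Sum using (_⊎_; inj₁; inj₂)
import Data.Vec.Base as Vec
open import Data.Vec.Properties using (lookup∘tabulate)
open import Function.Base using (_∘_; id; case_of_)
open import Function.Bundles using (_⇔_; Inverse; mk⇔; mk↔ₛ′)
open import Function.Definitions using (Injective)
open import Level using (0ℓ)
open import Relation.Binary.Bundles using (DecSetoid; Setoid)
import Relation.Binary.Construct.Closure.Equivalence as Eq
open import Relation.Binary.Construct.Closure.ReflexiveTransitive using (ε; _◅_)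
open import Relation.Binary.Construct.Closure.Symmetric using (fwd; bwd)
open import Relation.Binary.Core using (Rel)
open import Relation.Binary.Definitions using (DecidableEquality; tri<; tri≈; tri>)
open import Relation.Binary.PropositionalEquality
  using (_≡_; _≢_; _≗_; refl; sym; trans; cong; cong₂; subst; subst₂; ≢-sym; module ≡-Reasoning)
open import Relation.Nullary.Decidable
  using (Dec; yes; no; does; ¬?; map′; from-yes; _×-dec_; _⊎-dec_; _→-dec_)
open import Relation.Nullary.Negation using (¬_; contradiction)

private variable
  n m : ℕ

-- Counting orbits by independent and covering lists.

AllPairs-lookup : ∀ {A : Set} {R : Rel A 0ℓ} {xs : List A} → AllPairs R xs →
  ∀ {i j} → i Fin.< j → R (lookup xs i) (lookup xs j)
AllPairs-lookup (px ∷ _)  {Fin.zero}  {Fin.suc j} _         = All.lookup px (∈-lookup j)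
AllPairs-lookup (_ ∷ pxs) {Fin.suc i} {Fin.suc j} (s≤s i<j) = AllPairs-lookup pxs i<j

module _ (S : Setoid 0ℓ 0ℓ) where
  private module S = Setoid S

  -- Pigeonhole: two independent elements covered by the same entry of `ys` would be equivalent.
  independent-≤-covering : ∀ {xs ys} → AllPairs S._≉_ xs → (∀ x → Any (x S.≈_) ys) →
    length xs ≤ length ys
  independent-≤-covering {xs} {ys} independent covering = ≮⇒≥ λ ys<xs →
    case Fin.pigeonhole ys<xs (index ∘ covering ∘ lookup xs) of λ where
      (i , j , i<j , same) → AllPairs-lookup independent i<j
        (S.trans (Any.lookup-index (covering (lookup xs i)))
          (subst (λ k → lookup ys k S.≈ lookup xs j) (sym same)
            (S.sym (Any.lookup-index (covering (lookup xs j))))))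

orbitSetoid : (σ τ : Flag n → Flag n) → DecSetoid 0ℓ 0ℓ
orbitSetoid σ τ = record
  { isDecEquivalence = record
    { isEquivalence = Eq.isEquivalence (λ x y → σ x ≡ y ⊎ τ x ≡ y)
    ; _≟_           = sameOrbit? σ τ
    }
  }

module _ (σ τ : Flag n → Flag n) where
  open DecSetoid (orbitSetoid σ τ) using (setoid; _≉_) renaming (sym to ≈-sym; trans to ≈-trans)

  orbitsOf : List (Flag n) → List (Flag n)
  orbitsOf = deduplicate (sameOrbit? σ τ)

  orbitsOf-independent : ∀ xs → AllPairs _≉_ (orbitsOf xs)
  orbitsOf-independent = deduplicate-! (orbitSetoid σ τ)

  orbitsOf-covering : ∀ {xs} x → Any (SameOrbit σ τ x) xs → Any (SameOrbit σ τ x) (orbitsOf xs)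
  orbitsOf-covering x = Any.deduplicate⁺ (sameOrbit? σ τ) (λ z∼y x∼y → ≈-trans x∼y (≈-sym z∼y))

  flags-covering : ∀ x → Any (SameOrbit σ τ x) (flags n)
  flags-covering x = Any.map (λ { refl → Eq.reflexive _ }) (∈-flags x)

  independent⇒≤#orbits : ∀ {xs} → AllPairs _≉_ xs → length xs ≤ #orbits σ τ
  independent⇒≤#orbits independent = independent-≤-covering setoid independent
    (λ x → orbitsOf-covering x (flags-covering x))

  covering⇒#orbits≤ : ∀ {xs} → (∀ x → Any (SameOrbit σ τ x) xs) → #orbits σ τ ≤ length xs
  covering⇒#orbits≤ = independent-≤-covering setoid (orbitsOf-independent (flags n))

  0<#orbits : Flag n → 0 < #orbits σ τ
  0<#orbits x = independent⇒≤#orbits {x ∷ []} ([] ∷ [])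

-- Representatives of different orbits stay inequivalent under a map that reflects the orbit
-- relation.
#orbits-mono : (σ τ : Flag n → Flag n) (σ′ τ′ : Flag m → Flag m) (φ : Flag n → Flag m) →
  (∀ {x y} → SameOrbit σ′ τ′ (φ x) (φ y) → SameOrbit σ τ x y) → #orbits σ τ ≤ #orbits σ′ τ′
#orbits-mono {n} σ τ σ′ τ′ φ reflects = subst (_≤ #orbits σ′ τ′) (length-map φ reps)
  (independent⇒≤#orbits σ′ τ′ (AllPairs.map⁺ (AllPairs.map (λ x≁y φx∼φy → x≁y (reflects φx∼φy))
    (orbitsOf-independent σ τ (flags n)))))
  where reps = orbitsOf σ τ (flags n)

SameOrbit-map : (σ τ : Flag n → Flag n) (σ′ τ′ : Flag m → Flag m) (φ : Flag n → Flag m) →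
  (∀ x → φ (σ x) ≡ σ′ (φ x)) → (∀ x → φ (τ x) ≡ τ′ (φ x)) →
  ∀ {x y} → SameOrbit σ τ x y → SameOrbit σ′ τ′ (φ x) (φ y)
SameOrbit-map σ τ σ′ τ′ φ φσ φτ = Eq.gmap φ λ where
  (inj₁ refl) → inj₁ (sym (φσ _))
  (inj₂ refl) → inj₂ (sym (φτ _))

#orbits-conj-≤ : (σ τ : Flag n → Flag n) (σ′ τ′ : Flag m → Flag m)
  (φ : Flag n → Flag m) (ψ : Flag m → Flag n) → (∀ x → ψ (φ x) ≡ x) →
  (∀ x → ψ (σ′ x) ≡ σ (ψ x)) → (∀ x → ψ (τ′ x) ≡ τ (ψ x)) →
  #orbits σ τ ≤ #orbits σ′ τ′
#orbits-conj-≤ σ τ σ′ τ′ φ ψ ψφ ψσ ψτ = #orbits-mono σ τ σ′ τ′ φ λ {x} {y} r →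
  subst₂ (SameOrbit σ τ) (ψφ x) (ψφ y) (SameOrbit-map σ′ τ′ σ τ ψ ψσ ψτ r)

#orbits-conj : (σ τ : Flag n → Flag n) (σ′ τ′ : Flag m → Flag m)
  (φ : Flag n → Flag m) (ψ : Flag m → Flag n) → (∀ x → φ (ψ x) ≡ x) → (∀ x → ψ (φ x) ≡ x) →
  (∀ x → φ (σ x) ≡ σ′ (φ x)) → (∀ x → φ (τ x) ≡ τ′ (φ x)) →
  #orbits σ τ ≡ #orbits σ′ τ′
#orbits-conj σ τ σ′ τ′ φ ψ φψ ψφ φσ φτ = ≤-antisym
  (#orbits-conj-≤ σ τ σ′ τ′ φ ψ ψφ (inverse σ σ′ φσ) (inverse τ τ′ φτ))
  (#orbits-conj-≤ σ′ τ′ σ τ ψ φ φψ φσ φτ)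
  where
  inverse : ∀ α α′ → (∀ x → φ (α x) ≡ α′ (φ x)) → ∀ x → ψ (α′ x) ≡ α (ψ x)
  inverse α α′ φα x =
    trans (cong (ψ ∘ α′) (sym (φψ x))) (trans (cong ψ (sym (φα (ψ x)))) (ψφ (α (ψ x))))

#orbits-cong : (σ : Flag n → Flag n) {τ τ′ : Flag n → Flag n} → τ ≗ τ′ → #orbits σ τ ≡ #orbits σ τ′
#orbits-cong σ {τ} {τ′} eq =
  #orbits-conj σ τ σ τ′ id id (λ _ → refl) (λ _ → refl) (λ _ → refl) eq

#orbits-swap : (σ τ : Flag n → Flag n) → #orbits σ τ ≡ #orbits τ σ
#orbits-swap σ τ = ≤-antisym
  (#orbits-mono σ τ τ σ id (Eq.map Sum.swap)) (#orbits-mono τ σ σ τ id (Eq.map Sum.swap))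

-- Only the orbits of `a` and `b` are united. Dropping `b` from a list of representatives that
-- starts with it therefore leaves representatives of the new orbits.
#orbits-merge : (σ τ σ′ τ′ : Flag n → Flag n) {a b : Flag n} →
  (∀ {x y} → SameOrbit σ τ x y → SameOrbit σ′ τ′ x y) →
  (∀ {x y} → SameOrbit σ′ τ′ x y → SameOrbit σ τ x y ⊎
    (SameOrbit σ τ a x ⊎ SameOrbit σ τ b x) × (SameOrbit σ τ a y ⊎ SameOrbit σ τ b y)) →
  ¬ SameOrbit σ τ a b → SameOrbit σ′ τ′ a b →
  #orbits σ τ ≡ suc (#orbits σ′ τ′)
#orbits-merge {n} σ τ σ′ τ′ {a} {b} refines merges a≁b a∼′b = ≤-antisym
  (≤-trans (covering⇒#orbits≤ σ τ (λ x → orbitsOf-covering σ τ x (there (flags-covering σ τ x))))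
           (s≤s (independent⇒≤#orbits σ′ τ′ others-independent)))
  (≤-trans (s≤s (covering⇒#orbits≤ σ′ τ′ others-covering))
           (independent⇒≤#orbits σ τ (orbitsOf-independent σ τ (b ∷ flags n))))
  where
  module R  = DecSetoid (orbitSetoid σ τ)
  module R′ = DecSetoid (orbitSetoid σ′ τ′)
  reps = orbitsOf σ τ (flags n)
  -- By computation `b ∷ others` is `orbitsOf σ τ (b ∷ flags n)`, so `b` stands for its own orbit.
  others = filter (¬? ∘ sameOrbit? σ τ b) reps

  separate : ∀ {x y} → b R.≉ x × x R.≉ y → b R.≉ y → x R′.≉ y
  separate (b≁x , x≁y) b≁y x∼′y with merges x∼′y
  ... | inj₁ x∼y                     = x≁y x∼y
  ... | inj₂ (inj₂ b∼x , _)          = b≁x b∼x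
  ... | inj₂ (_ , inj₂ b∼y)          = b≁y b∼y
  ... | inj₂ (inj₁ a∼x , inj₁ a∼y)   = x≁y (R.trans (R.sym a∼x) a∼y)

  independent′ : ∀ {xs} → All (b R.≉_) xs → AllPairs R._≉_ xs → AllPairs R′._≉_ xs
  independent′ []         []         = []
  independent′ (bx ∷ bxs) (px ∷ pxs) =
    All.zipWith (λ (x≁y , b≁y) → separate (bx , x≁y) b≁y) (px , bxs) ∷ independent′ bxs pxs

  others-independent : AllPairs R′._≉_ others
  others-independent with _ ∷ pxs ← orbitsOf-independent σ τ (b ∷ flags n) =
    independent′ (all-filter (¬? ∘ sameOrbit? σ τ b) reps) pxs

  covered : ∀ x → Any (x R.≈_) (b ∷ others)
  covered x = orbitsOf-covering σ τ x (there (flags-covering σ τ x))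

  others-covering : ∀ x → Any (x R′.≈_) others
  others-covering x with covered x
  ... | there x∈ = Any.map refines x∈
  ... | here x∼b with covered a
  ...   | here a∼b  = contradiction a∼b a≁b
  ...   | there a∈ = Any.map (λ a∼y → R′.trans (refines x∼b) (R′.trans (R′.sym a∼′b) (refines a∼y))) a∈

SameOrbit-closed : {σ τ : Flag n → Flag n} (P : Flag n → Set) →
  (∀ x → σ (σ x) ≡ x) → (∀ x → τ (τ x) ≡ x) →
  (∀ {x} → P x → P (σ x)) → (∀ {x} → P x → P (τ x)) →
  ∀ {x y} → SameOrbit σ τ x y → P x → P y
SameOrbit-closed P σσ ττ Pσ Pτ ε Px = Px
SameOrbit-closed P σσ ττ Pσ Pτ (fwd (inj₁ refl) ◅ r) Px = SameOrbit-closed P σσ ττ Pσ Pτ r (Pσ Px)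
SameOrbit-closed P σσ ττ Pσ Pτ (fwd (inj₂ refl) ◅ r) Px = SameOrbit-closed P σσ ττ Pσ Pτ r (Pτ Px)
SameOrbit-closed P σσ ττ Pσ Pτ (bwd (inj₁ refl) ◅ r) Px =
  SameOrbit-closed P σσ ττ Pσ Pτ r (subst P (σσ _) (Pσ Px))
SameOrbit-closed P σσ ττ Pσ Pτ (bwd (inj₂ refl) ◅ r) Px =
  SameOrbit-closed P σσ ττ Pσ Pτ r (subst P (ττ _) (Pτ Px))

-- Iterates and least periods.

module _ {A : Set} (f : A → A) where

  iterate-suc : ∀ x k → iterate f x (suc k) ≡ f (iterate f x k)
  iterate-suc x zero    = refl
  iterate-suc x (suc k) = iterate-suc (f x) k

  iterate-+ : ∀ x j k → iterate f x (j + k) ≡ iterate f (iterate f x j) k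
  iterate-+ x zero    k = refl
  iterate-+ x (suc j) k = iterate-+ (f x) j k

  iterate-injective : Injective _≡_ _≡_ f → ∀ k {x y} → iterate f x k ≡ iterate f y k → x ≡ y
  iterate-injective inj zero    eq = eq
  iterate-injective inj (suc k) eq = inj (iterate-injective inj k eq)

module _ (f : Flag n → Flag n) where

  IsLeastPeriod : Flag n → ℕ → Set
  IsLeastPeriod x N = 0 < N × iterate f x N ≡ x × (∀ k → 0 < k → k < N → iterate f x k ≢ x)

  private
    Period : Flag n → ℕ → Set
    Period x N = 0 < N × iterate f x N ≡ x

    least : ∀ x N → Period x N → ∃[ N ] IsLeastPeriod x N
    least x = <-rec _ λ N smaller (0<N , fᴺx≡x) →
      case anyUpTo? (λ k → (0 <? k) ×-dec (iterate f x k ≟ᶠ x)) N of λ where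
        (yes (k , k<N , period)) → smaller k<N period
        (no none)                → N , 0<N , fᴺx≡x , λ k 0<k k<N eq → none (k , k<N , 0<k , eq)

  module _ (inj : Injective _≡_ _≡_ f) (x : Flag n) where

    -- There are finitely many flags, so two iterates coincide; injectivity cancels the steps that
    -- they share.
    least-period : ∃[ N ] IsLeastPeriod x N
    least-period =
      let place = λ i → index (∈-flags (iterate f x (toℕ i)))
          i , j , i<j , same = Fin.pigeonhole (n<1+n (length (flags n))) place
          fⁱx≡fʲx : iterate f x (toℕ i) ≡ iterate f x (toℕ j)
          fⁱx≡fʲx = trans (Any.lookup-index (∈-flags _))
            (trans (cong (lookup (flags n)) same) (sym (Any.lookup-index (∈-flags _))))
          d = toℕ j ∸ toℕ i
          fᵈx≡x = iterate-injective f inj (toℕ i)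
            (trans (sym (iterate-+ f x d (toℕ i)))
              (trans (cong (iterate f x) (m∸n+n≡m (<⇒≤ i<j))) (sym fⁱx≡fʲx)))
      in least x d (m<n⇒0<n∸m i<j , fᵈx≡x)

    iterate-reduce : ∀ {N} → IsLeastPeriod x N → ∀ k → ∃[ r ] r < N × iterate f x k ≡ iterate f x r
    iterate-reduce (0<N , _) zero = zero , 0<N , refl
    iterate-reduce {N} period@(0<N , fᴺx≡x , _) (suc k) with iterate-reduce period k
    ... | r , r<N , eq with suc r ≟ N
    ...   | no r+1≢N = suc r , ≤∧≢⇒< r<N r+1≢N ,
      trans (iterate-suc f x k) (trans (cong f eq) (sym (iterate-suc f x r)))
    ...   | yes refl = 0 , 0<N ,
      trans (iterate-suc f x k) (trans (cong f eq) (trans (sym (iterate-suc f x r)) fᴺx≡x))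

    -- Going on to the end of the period replaces going backwards.
    iterate-reverse : ∀ k {y} → iterate f x k ≡ y → ∃[ l ] iterate f y l ≡ x
    iterate-reverse k refl =
      let N , period@(_ , fᴺx≡x , _) = least-period
          r , r<N , eq = iterate-reduce period k
      in N ∸ r , trans (cong (λ y → iterate f y (N ∸ r)) eq)
        (trans (sym (iterate-+ f x r (N ∸ r)))
          (trans (cong (iterate f x) (m+[n∸m]≡n (<⇒≤ r<N))) fᴺx≡x))

even⊎odd : ∀ k → (∃[ j ] k ≡ j + j) ⊎ (∃[ j ] k ≡ suc (j + j))
even⊎odd zero = inj₁ (0 , refl)
even⊎odd (suc k) with even⊎odd k
... | inj₁ (j , refl) = inj₂ (j , refl)
... | inj₂ (j , refl) = inj₁ (suc j , cong suc (sym (+-suc j j)))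

m+m-injective : ∀ j k → j + j ≡ k + k → j ≡ k
m+m-injective j k eq with <-cmp j k
... | tri< j<k _ _ = contradiction eq (<⇒≢ (+-mono-< j<k j<k))
... | tri≈ _ j≡k _ = j≡k
... | tri> _ _ j>k = contradiction (sym eq) (<⇒≢ (+-mono-< j>k j>k))

-- Orbits of two involutions.

module Dihedral {A : Set} (σ τ : A → A)
  (σσ : ∀ x → σ (σ x) ≡ x) (ττ : ∀ x → τ (τ x) ≡ x) (τ-fpf : ∀ x → τ x ≢ x) where

  step : A → A
  step x = σ (τ x)

  step-injective : Injective _≡_ _≡_ step
  step-injective {x} {y} eq =
    trans (sym (ττ x)) (trans (cong τ (trans (sym (σσ _)) (trans (cong σ eq) (σσ _)))) (ττ y))

  step-σ : ∀ x → step (σ (step x)) ≡ σ x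
  step-σ x = cong σ (trans (cong τ (σσ _)) (ττ x))

  step-τ : ∀ x → step (τ (step x)) ≡ τ x
  step-τ x = trans (cong σ (ττ _)) (σσ _)

  -- Conjugation by `σ` inverts `step`.
  iterate-σ : ∀ k x → iterate step (σ (iterate step x k)) k ≡ σ x
  iterate-σ zero    x = refl
  iterate-σ (suc k) x = trans (iterate-suc step _ k)
    (trans (cong step (iterate-σ k (step x))) (step-σ x))

  iterate-τ : ∀ k x → iterate step (τ (iterate step x k)) k ≡ τ x
  iterate-τ zero    x = refl
  iterate-τ (suc k) x = trans (iterate-suc step _ k)
    (trans (cong step (iterate-τ k (step x))) (step-τ x))

  -- Moving the two points towards each other ends at a fixed point of σ or τ.
  private
    apart : (∀ x → σ x ≢ x) → ∀ x d k → iterate step x (d + k) ≢ τ (iterate step x k)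
    apart σ-fpf x zero k eq = τ-fpf _ (sym eq)
    apart σ-fpf x (suc zero) k eq = σ-fpf _ (trans (sym (iterate-suc step x k)) eq)
    apart σ-fpf x (suc (suc d)) k eq = apart σ-fpf x d (suc k) (begin
      iterate step x (d + suc k)                  ≡⟨ cong (iterate step x) (+-suc d k) ⟩
      iterate step x (suc d + k)                  ≡⟨ ττ _ ⟨
      τ (τ (iterate step x (suc d + k)))          ≡⟨ cong τ (σσ _) ⟨
      τ (σ (step (iterate step x (suc d + k))))
        ≡⟨ cong (τ ∘ σ) (trans (sym (iterate-suc step x (suc d + k))) eq) ⟩
      τ (step (iterate step x k))                 ≡⟨ cong τ (iterate-suc step x k) ⟨
      τ (iterate step x (suc k))                  ∎)
      where open ≡-Reasoning

  -- Without fixed points the orbits are circles. Iterating `step` goes around in one direction, and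
  -- `τ` leads to the points of the opposite direction.
  iterate≢τ-iterate : (∀ x → σ x ≢ x) → ∀ x j k → iterate step x j ≢ τ (iterate step x k)
  iterate≢τ-iterate σ-fpf x j k eq with ≤-total k j
  ... | inj₁ k≤j = apart σ-fpf x (j ∸ k) k (subst (λ i → iterate step x i ≡ _) (sym (m∸n+n≡m k≤j)) eq)
  ... | inj₂ j≤k = apart σ-fpf x (k ∸ j) j
    (subst (λ i → iterate step x i ≡ _) (sym (m∸n+n≡m j≤k)) (trans (sym (ττ _)) (cong τ (sym eq))))

module Fixed (σ τ : Flag n → Flag n)
  (σσ : ∀ x → σ (σ x) ≡ x) (ττ : ∀ x → τ (τ x) ≡ x) (τ-fpf : ∀ x → τ x ≢ x) where
  open Dihedral σ τ σσ ττ τ-fpf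

  -- Without its fixed points, σ would turn every orbit into a circle; a fixed
  -- point makes it a path, with exactly one further fixed point at its other end.
  otherEnd : ∀ x → σ x ≡ x → ∃[ y ] y ≢ x × σ y ≡ y × SameOrbit τ σ x y ×
    (∀ z → σ z ≡ z → SameOrbit τ σ x z → z ≡ x ⊎ z ≡ y)
  otherEnd x σx≡x with least-period step step-injective x
  ... | N , period@(0<N , sᴺx≡x , minimal) with even⊎odd N
  -- As `σ x ≡ x`, `σ` exchanges the iterates `k` steps after and before `x`. With period 2M + 1
  -- this would make the M-th iterate a fixed point of `τ`; with period 2M it is fixed by `σ` and is
  -- the other end.
  ...   | inj₂ (M , refl) = contradiction fixed (τ-fpf (s M))
    where
    s : ℕ → Flag _
    s = iterate step x
    fixed : τ (s M) ≡ s M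
    fixed = sym (trans (sym (σσ _)) (trans (cong σ (iterate-injective step step-injective M (begin
      iterate step (σ (s M)) M        ≡⟨ iterate-σ M x ⟩
      σ x                             ≡⟨ σx≡x ⟩
      x                               ≡⟨ sᴺx≡x ⟨
      s (suc M + M)                   ≡⟨ iterate-+ step x (suc M) M ⟩
      iterate step (s (suc M)) M      ∎))) (trans (cong σ (iterate-suc step x M)) (σσ _))))
      where open ≡-Reasoning
  ...   | inj₁ (M , refl) = s M , sᴹx≢x , fixed , connected M , unique
    where
    s : ℕ → Flag _
    s = iterate step x

    0<M : 0 < M
    0<M = n≢0⇒n>0 λ { refl → contradiction 0<N (<-irrefl refl) }

    sᴹx≢x : s M ≢ x
    sᴹx≢x = minimal M 0<M (m<m+n M 0<M)

    fixed : σ (s M) ≡ s M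
    fixed = iterate-injective step step-injective M
      (trans (iterate-σ M x) (trans σx≡x (trans (sym sᴺx≡x) (iterate-+ step x M M))))

    connected : ∀ k → SameOrbit τ σ x (s k)
    connected zero    = ε
    connected (suc k) rewrite iterate-suc step x k = Eq.transitive _ (connected k)
      (fwd (inj₁ refl) ◅ fwd (inj₂ refl) ◅ ε)

    Visited : Flag _ → Set
    Visited y = ∃[ k ] (y ≡ s k ⊎ y ≡ τ (s k))

    visited-τ : ∀ {y} → Visited y → Visited (τ y)
    visited-τ (k , inj₁ refl) = k , inj₂ refl
    visited-τ (k , inj₂ refl) = k , inj₁ (ττ _)

    visited-σ : ∀ {y} → Visited y → Visited (σ y)
    visited-σ (zero  , inj₁ refl) = 0 , inj₁ σx≡x
    visited-σ (suc k , inj₁ refl) = k , inj₂ (trans (cong σ (iterate-suc step x k)) (σσ _))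
    visited-σ (k     , inj₂ refl) = suc k , inj₁ (sym (iterate-suc step x k))

    unique : ∀ z → σ z ≡ z → SameOrbit τ σ x z → z ≡ x ⊎ z ≡ s M
    unique z σz≡z x∼z =
      let r , r<N , z≡sʳx = position (SameOrbit-closed Visited ττ σσ visited-τ visited-σ x∼z (0 , inj₁ refl))
      in locate r r<N z≡sʳx
      where
      position : Visited z → ∃[ r ] r < M + M × z ≡ s r
      position (k , inj₁ refl) = iterate-reduce step step-injective x period k
      -- Here `z` is `τ (s k)`, and `σ z ≡ z` identifies it with the next iterate.
      position (k , inj₂ refl) =
        let r , r<N , eq = iterate-reduce step step-injective x period (suc k)
        in r , r<N , trans (sym σz≡z) (trans (sym (iterate-suc step x k)) eq)

      locate : ∀ r → r < M + M → z ≡ s r → z ≡ x ⊎ z ≡ s M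
      locate zero      _   z≡x  = inj₁ z≡x
      -- Reflection in the fixed point `z` takes `x` to the iterate number 2r, which is thus `x`
      -- again. From 0 < 2r < 2N it follows that 2r = N = 2M.
      locate r@(suc _) r<N refl = inj₂ (cong s (m+m-injective r M (halve (<-cmp (r + r) (M + M)))))
        where
        s²ʳx≡x : s (r + r) ≡ x
        s²ʳx≡x = trans (iterate-+ step x r r)
          (trans (cong (λ y → iterate step y r) (sym σz≡z)) (trans (iterate-σ r x) σx≡x))

        halve : _ → r + r ≡ M + M
        halve (tri< 2r<N _ _) = contradiction s²ʳx≡x (minimal (r + r) (s≤s z≤n) 2r<N)
        halve (tri≈ _ 2r≡N _) = 2r≡N
        halve (tri> _ _ 2r>N) = contradiction
          (trans (cong (λ y → iterate step y d) (sym sᴺx≡x))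
            (trans (sym (iterate-+ step x (M + M) d))
              (trans (cong s (m+[n∸m]≡n (<⇒≤ 2r>N))) s²ʳx≡x)))
          (minimal d (m<n⇒0<n∸m 2r>N)
            (subst (d <_) (m+n∸m≡n (M + M) (M + M))
              (∸-monoˡ-< (+-mono-< r<N r<N) (<⇒≤ 2r>N))))
          where d = r + r ∸ (M + M)

-- The Klein four-group on the corners of a ribbon.

-- The ways of travelling between the corners of a ribbon form a Klein four-group:
-- (u , v) changes the end if u, and the side if v.  A boundary passes an absent
-- ribbon along its ends and a present one along its sides.
Mode : Set
Mode = Bool × Bool

pattern none  = false , false
pattern ends  = false , true
pattern sides = true , false
pattern cross = true , true

_⊕_ : Mode → Mode → Mode
(u , v) ⊕ (h , s) = u xor h , v xor s

_·_ : Mode → Flag n → Flag n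
i · (e , x) = e , i ⊕ x

_≟ᵐ_ : DecidableEquality Mode
_≟ᵐ_ = ≡-dec Bool._≟_ Bool._≟_

allModes? : {P : Mode → Set} → (∀ i → Dec (P i)) → Dec (∀ i → P i)
allModes? P? = map′
  (λ { (p , q , r , s) → λ { none → p ; ends → q ; sides → r ; cross → s } })
  (λ p → p none , p ends , p sides , p cross)
  (P? none ×-dec P? ends ×-dec P? sides ×-dec P? cross)

⊕-cancelˡ : ∀ i j → i ⊕ (i ⊕ j) ≡ j
⊕-cancelˡ = from-yes (allModes? λ i → allModes? λ j → (i ⊕ (i ⊕ j)) ≟ᵐ j)

⊕-comm : ∀ i j → i ⊕ j ≡ j ⊕ i
⊕-comm = from-yes (allModes? λ i → allModes? λ j → (i ⊕ j) ≟ᵐ (j ⊕ i))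

⊕-assoc : ∀ i j k → (i ⊕ j) ⊕ k ≡ i ⊕ (j ⊕ k)
⊕-assoc = from-yes (allModes? λ i → allModes? λ j → allModes? λ k → ((i ⊕ j) ⊕ k) ≟ᵐ (i ⊕ (j ⊕ k)))

klein : ∀ i j → i ≢ none → j ≢ none → i ≢ j → ∀ k → k ≡ none ⊎ k ≡ i ⊎ k ≡ j ⊎ k ≡ i ⊕ j
klein = from-yes (allModes? λ i → allModes? λ j →
  ¬? (i ≟ᵐ none) →-dec ¬? (j ≟ᵐ none) →-dec ¬? (i ≟ᵐ j) →-dec
  allModes? λ k → (k ≟ᵐ none) ⊎-dec (k ≟ᵐ i) ⊎-dec (k ≟ᵐ j) ⊎-dec (k ≟ᵐ (i ⊕ j)))

·-involutive : ∀ i (x : Flag n) → i · (i · x) ≡ x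
·-involutive i (e , x) = cong (e ,_) (⊕-cancelˡ i x)

·-free : ∀ {i j} {x : Flag n} → i · x ≡ j · x → i ≡ j
·-free {i = i} {j} {e , x} eq = trans (sym (cancelʳ i)) (trans (cong (λ y → proj₂ y ⊕ x) eq) (cancelʳ j))
  where
  cancelʳ : ∀ k → (k ⊕ x) ⊕ x ≡ k
  cancelʳ k = trans (⊕-comm (k ⊕ x) x) (trans (cong (x ⊕_) (⊕-comm k x)) (⊕-cancelˡ x k))

sameEdge : (x y : Flag n) → edge x ≡ edge y → ∃[ i ] y ≡ i · x
sameEdge (e , x) (e , y) refl =
  y ⊕ x , cong (e ,_) (sym (trans (⊕-assoc y x x)
    (trans (cong (y ⊕_) (x⊕x x)) (⊕-comm y none))))
  where
  x⊕x : ∀ x → x ⊕ x ≡ none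
  x⊕x = from-yes (allModes? λ x → (x ⊕ x) ≟ᵐ none)

-- The three states of a ribbon and the number of components.

Config : ℕ → Set
Config n = Fin n → Mode

-- In mode `none` the corners of a ribbon are fixed points: the ribbon is cut out and leaves four
-- loose ends.
turn : Config n → Flag n → Flag n
turn c x = c (edge x) · x

turn-involutive : (c : Config n) → ∀ x → turn c (turn c x) ≡ x
turn-involutive c x = ·-involutive (c (edge x)) x

-- Numbers of components for a ribbon in the states `ends`, `sides` and `cross`, in this order. The
-- constructor tells which state agrees with the pairing of the corners by the rest of the surface.
data Trio : ℕ → ℕ → ℕ → Set where
  first  : ∀ {k} → Trio (suc k) k k
  second : ∀ {k} → Trio k (suc k) k
  third  : ∀ {k} → Trio k k (suc k)

module Matching (τ : Flag n → Flag n)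
  (ττ : ∀ x → τ (τ x) ≡ x) (τ-fpf : ∀ x → τ x ≢ x) where

  # : Config n → ℕ
  # c = #orbits τ (turn c)

  _∼[_]_ : Flag n → Config n → Flag n → Set
  x ∼[ c ] y = SameOrbit τ (turn c) x y

  #-cong : ∀ {c c′ : Config n} → c ≗ c′ → # c ≡ # c′
  #-cong eq = #orbits-cong τ (λ x → cong (_· x) (eq (edge x)))

  module Switch (c₀ : Config n) (e : Fin n)
    (c₀e : c₀ e ≡ none) (c₀≢none : ∀ f → f ≢ e → c₀ f ≢ none) where

    -- With e turned off, its four corners are the ends of two paths.
    private
      corner : Flag n
      corner = e , none

      _∼_ : Flag n → Flag n → Set
      _∼_ = _∼[ c₀ ]_

      turn-fixed : ∀ {x} → edge x ≡ e → turn c₀ x ≡ x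
      turn-fixed refl = cong (_· _) c₀e

      onEdge : ∀ x → turn c₀ x ≡ x → edge x ≡ e
      onEdge x eq with edge x Fin.≟ e
      ... | yes x∈e = x∈e
      ... | no  x∉e = contradiction (·-free {x = x} eq) (c₀≢none _ x∉e)

      abstract
        -- The fixed points of `turn c₀` are exactly the corners of `e`, so a path that starts at
        -- one of them ends at another.
        mate : ∀ x → edge x ≡ e → ∃[ i ] i ≢ none × x ∼ (i · x) ×
          (∀ j → x ∼ (j · x) → j ≡ none ⊎ j ≡ i)
        mate x x∈e =
          let y , y≢x , fixed , x∼y , unique =
                Fixed.otherEnd (turn c₀) τ (turn-involutive c₀) ττ τ-fpf x (turn-fixed x∈e)
              i , y≡ix = sameEdge x y (trans x∈e (sym (onEdge y fixed)))
          in i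
           , (λ i≡none → y≢x (trans y≡ix (cong (_· x) i≡none)))
           , subst (x ∼_) y≡ix x∼y
           , λ j x∼jx → Sum.map (·-free {x = x}) (λ eq → ·-free {x = x} (trans eq y≡ix))
               (unique (j · x) (turn-fixed x∈e) x∼jx)

    -- The pairing of the corners of `e` by the rest of the surface, read off at one reference
    -- corner.
    i* : Mode
    i* = proj₁ (mate corner refl)

    i*≢none : i* ≢ none
    i*≢none = proj₁ (proj₂ (mate corner refl))

    private
      corner∼ : corner ∼ (i* · corner)
      corner∼ = proj₁ (proj₂ (proj₂ (mate corner refl)))

      corner-unique : ∀ j → corner ∼ (j · corner) → j ≡ none ⊎ j ≡ i*
      corner-unique = proj₂ (proj₂ (proj₂ (mate corner refl)))

      ∼-trans : ∀ {x y z} → x ∼ y → y ∼ z → x ∼ z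
      ∼-trans = Eq.transitive _

      ∼-sym : ∀ {x y} → x ∼ y → y ∼ x
      ∼-sym = Eq.symmetric _

      mode-of : ∀ x → edge x ≡ e → ∃[ g ] x ≡ g · corner
      mode-of x x∈e = sameEdge corner x (sym x∈e)

      -- The reference corner and its mate are already paired, so the other two corners must be
      -- mates of each other; in the Klein group they differ by `i*` as well.
      mate≡i* : ∀ x → edge x ≡ e → x ∼ (i* · x)
      mate≡i* x x∈e with g , refl ← mode-of x x∈e with g ≟ᵐ none | g ≟ᵐ i*
      ... | yes refl | _        = corner∼
      ... | no _     | yes refl = subst ((i* · corner) ∼_) (sym (·-involutive i* corner)) (∼-sym corner∼)
      ... | no g≢none | no g≢i* with j , j≢none , x∼jx , _ ← mate (g · corner) refl
        with klein g i* g≢none i*≢none g≢i* j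
      ...   | inj₁ j≡none = contradiction j≡none j≢none
      ...   | inj₂ (inj₁ refl) = contradiction
        (∼-sym (subst ((g · corner) ∼_) (·-involutive g corner) x∼jx)) (λ r → Sum.[ g≢none , g≢i* ]′ (corner-unique g r))
      ...   | inj₂ (inj₂ (inj₁ refl)) = x∼jx
      ...   | inj₂ (inj₂ (inj₂ refl)) = contradiction
        (∼-trans corner∼ (∼-sym (subst ((g · corner) ∼_) gi*g x∼jx))) (λ r → Sum.[ g≢none , g≢i* ]′ (corner-unique g r))
        where
        gi*g : (g ⊕ i*) · (g · corner) ≡ i* · corner
        gi*g = cong (e ,_) (trans (cong (_⊕ (g ⊕ none)) (⊕-comm g i*))
          (trans (⊕-assoc i* g (g ⊕ none)) (cong (i* ⊕_) (⊕-cancelˡ g none))))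

    module _ (c : Config n) (agree : ∀ f → f ≢ e → c f ≡ c₀ f) where

      private
        step-off : ∀ {x} → edge x ≢ e → turn c x ≡ turn c₀ x
        step-off x∉e = cong (_· _) (agree _ x∉e)

        refines : ∀ {x y} → x ∼ y → x ∼[ c ] y
        refines = Eq.fold (Eq.isEquivalence _) λ where
          (inj₁ eq) → fwd (inj₁ eq) ◅ ε
          {x} (inj₂ refl) → case edge x Fin.≟ e of λ where
            (yes x∈e) → subst (x ∼[ c ]_) (sym (turn-fixed x∈e)) ε
            (no  x∉e) → fwd (inj₂ (step-off x∉e)) ◅ ε

      #-split : c e ≡ i* → # c ≡ # c₀
      #-split ce = ≤-antisym (#orbits-mono τ (turn c) τ (turn c₀) id refines) (#orbits-mono τ (turn c₀) τ (turn c) id coarsens)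
        where
        -- Turning `e` by `i*` joins only corners that are joined already: each of the two paths
        -- closes up by itself.
        coarsens : ∀ {x y} → x ∼[ c ] y → x ∼ y
        coarsens = Eq.fold (Eq.isEquivalence _) λ where
          (inj₁ eq) → fwd (inj₁ eq) ◅ ε
          {x} (inj₂ refl) → case edge x Fin.≟ e of λ where
            (yes refl) → subst (λ i → x ∼ (i · x)) (sym ce) (mate≡i* x refl)
            (no  x∉e) → fwd (inj₂ (sym (step-off x∉e))) ◅ ε

      -- Any other state leads from one path to the other, so the two paths close up to a single
      -- circle.
      module _ (ce≢none : c e ≢ none) (ce≢i* : c e ≢ i*) where
        private
          Joined : Flag n → Set
          Joined x = corner ∼ x ⊎ (c e · corner) ∼ x

          -- The translates of `corner` by `none` and `i*` lie on its own path, those by `c e` and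
          -- `i* ⊕ c e` on the other.
          joined : ∀ x → edge x ≡ e → Joined x
          joined x x∈e with g , refl ← mode-of x x∈e
            with klein (c e) i* ce≢none i*≢none ce≢i* g
          ... | inj₁ refl = inj₁ ε
          ... | inj₂ (inj₁ refl) = inj₂ ε
          ... | inj₂ (inj₂ (inj₁ refl)) = inj₁ corner∼
          ... | inj₂ (inj₂ (inj₂ refl)) = inj₂ (subst ((c e · corner) ∼_)
            (cong (e ,_) (trans (sym (⊕-assoc i* (c e) none)) (cong (_⊕ none) (⊕-comm i* (c e)))))
            (mate≡i* (c e · corner) refl))

          joins : corner ∼[ c ] (c e · corner)
          joins = fwd (inj₂ refl) ◅ ε

          Merged : Flag n → Flag n → Set
          Merged x y = x ∼ y ⊎ Joined x × Joined y

          joined-resp : ∀ {x y} → x ∼ y → Joined x → Joined y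
          joined-resp x∼y = Sum.map (λ r → ∼-trans r x∼y) (λ r → ∼-trans r x∼y)

          merged-trans : ∀ {x y z} → Merged x y → Merged y z → Merged x z
          merged-trans (inj₁ xy)       (inj₁ yz)       = inj₁ (∼-trans xy yz)
          merged-trans (inj₁ xy)       (inj₂ (y , z))  = inj₂ (joined-resp (∼-sym xy) y , z)
          merged-trans (inj₂ (x , y))  (inj₁ yz)       = inj₂ (x , joined-resp yz y)
          merged-trans (inj₂ (x , _))  (inj₂ (_ , z))  = inj₂ (x , z)

          merges : ∀ {x y} → x ∼[ c ] y → Merged x y
          merges = Eq.fold
            (record { refl = inj₁ ε ; sym = Sum.map ∼-sym Product.swap ; trans = merged-trans })
            λ where
              (inj₁ eq) → inj₁ (fwd (inj₁ eq) ◅ ε)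
              {x} (inj₂ refl) → case edge x Fin.≟ e of λ where
                (yes refl) → inj₂ (joined x refl , joined (turn c x) refl)
                (no  x∉e) → inj₁ (fwd (inj₂ (sym (step-off x∉e))) ◅ ε)

        #-merge : # c₀ ≡ suc (# c)
        #-merge = #orbits-merge τ (turn c₀) τ (turn c) refines merges
          (λ r → Sum.[ ce≢none , ce≢i* ]′ (corner-unique (c e) r)) joins

        connected : ∀ {x y} → edge x ≡ e → edge y ≡ e → x ∼[ c ] y
        connected x∈e y∈e = Eq.transitive _ (Eq.symmetric _ (fromCorner x∈e)) (fromCorner y∈e)
          where
          fromCorner : ∀ {x} → edge x ≡ e → corner ∼[ c ] x
          fromCorner {x} x∈e with joined x x∈e
          ... | inj₁ r = refines r
          ... | inj₂ r = Eq.transitive _ joins (refines r)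

-- The states of two ribbons.

mode : Bool → Mode
mode b = if b then sides else ends

_[_↦_] : Config n → Fin n → Mode → Config n
(c [ e ↦ i ]) f = if does (f Fin.≟ e) then i else c f

update-same : ∀ (c : Config n) e i → (c [ e ↦ i ]) e ≡ i
update-same c e i with e Fin.≟ e
... | yes _  = refl
... | no e≢e = contradiction refl e≢e

update-other : ∀ (c : Config n) e i f → f ≢ e → (c [ e ↦ i ]) f ≡ c f
update-other c e i f f≢e with f Fin.≟ e
... | yes f≡e = contradiction f≡e f≢e
... | no _    = refl

-- The indices are the states of e and f: 0 for absent, 1 for present, 2 for crossed.
-- All other ribbons are absent in F and present in G.
trios-conflict : ∀ {K F₀₁ F₁₁ G₀₀ G₁₀ G₂₀ G₀₁ G₁₁ G₂₁ G₂₂} →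
  0 < F₀₁ → Trio F₀₁ F₁₁ 1 →
  1 + G₁₁ ≡ K → 1 + G₀₁ ≡ K → F₀₁ + G₁₀ ≡ K → F₁₁ + G₀₀ ≡ K →
  Trio G₀₀ G₁₀ G₂₀ → Trio G₀₁ G₁₁ G₂₁ → Trio G₂₀ G₂₁ G₂₂ → ⊥
trios-conflict 0<F₀₁ first  refl refl refl refl first  third ()
trios-conflict 0<F₀₁ second refl refl refl refl second third ()
trios-conflict ()    third

-- `F₂₀` is at least 2 while the first entry is 1, so `F₂₀` must be the larger entry.
trio-split : ∀ {F₁₀ F₂₀ F₂₁} → Trio 1 F₁₀ F₂₀ → F₂₀ ≡ suc F₂₁ → 0 < F₂₁ → F₁₀ ≡ 1 × F₂₁ ≡ 1
trio-split third  refl 0<F₂₁ = refl , refl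
trio-split second refl ()
trio-split first  ()   0<F₂₁

module Grid (τ : Flag n → Flag n) (ττ : ∀ x → τ (τ x) ≡ x) (τ-fpf : ∀ x → τ x ≢ x) where
  open Matching τ ττ τ-fpf

  module Switching (c : Mode → Config n) (e : Fin n)
    (here : ∀ i → c i e ≡ i) (off : ∀ i f → f ≢ e → c i f ≡ c none f)
    (active : ∀ f → f ≢ e → c none f ≢ none) where

    private
      module S = Switch (c none) e (here none) active

      split-merge : ∀ i → S.i* ≡ i → ∀ j → j ≢ none → j ≢ i → # (c i) ≡ suc (# (c j))
      split-merge i i*≡i j j≢none j≢i = trans
        (S.#-split (c i) (off i) (trans (here i) (sym i*≡i)))
        (S.#-merge (c j) (off j) (λ eq → j≢none (trans (sym (here j)) eq))
          (λ eq → j≢i (trans (sym (here j)) (trans eq i*≡i))))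

      merge-merge : ∀ i → S.i* ≡ i → ∀ j k → j ≢ none → j ≢ i → k ≢ none → k ≢ i → # (c j) ≡ # (c k)
      merge-merge i eq j k j≢none j≢i k≢none k≢i = suc-injective
        (trans (sym (split-merge i eq j j≢none j≢i)) (split-merge i eq k k≢none k≢i))

    -- The state equal to `i*` closes the two paths at `e` separately, and either of the other two
    -- states unites them.
    trio : Trio (# (c ends)) (# (c sides)) (# (c cross))
    trio = decide S.i* refl
      where
      decide : ∀ i → S.i* ≡ i → Trio (# (c ends)) (# (c sides)) (# (c cross))
      decide none  eq = contradiction eq S.i*≢none
      decide ends  eq = subst₂ (λ p q → Trio p q (# (c cross)))
        (sym (split-merge ends eq cross (λ ()) (λ ())))
        (merge-merge ends eq cross sides (λ ()) (λ ()) (λ ()) (λ ())) first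
      decide sides eq = subst₂ (λ p q → Trio p q (# (c cross)))
        (merge-merge sides eq cross ends (λ ()) (λ ()) (λ ()) (λ ()))
        (sym (split-merge sides eq cross (λ ()) (λ ()))) second
      decide cross eq = subst₂ (λ p q → Trio (# (c ends)) p q)
        (merge-merge cross eq ends sides (λ ()) (λ ()) (λ ()) (λ ()))
        (sym (split-merge cross eq ends (λ ()) (λ ()))) third

    -- A state other than `i*` puts all four corners of `e` into one component. Corners of `e` in
    -- different components therefore force `i*` to be `ends`.
    disconnected⇒split : ∀ {x y} → edge x ≡ e → edge y ≡ e → ¬ x ∼[ c ends ] y →
      # (c ends) ≡ suc (# (c sides))
    disconnected⇒split x∈e y∈e x≁y with S.i* ≟ᵐ ends
    ... | yes i*≡ends = split-merge ends i*≡ends sides (λ ()) (λ ())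
    ... | no  i*≢ends = contradiction
      (S.connected (c ends) (off ends) (λ eq → contradiction (trans (sym (here ends)) eq) λ ())
        (λ eq → i*≢ends (trans (sym eq) (here ends))) x∈e y∈e) x≁y

  module _ {e f : Fin n} (f≢e : f ≢ e) where

    grid : Mode → Mode → Mode → Config n
    grid r u v = ((λ _ → r) [ f ↦ v ]) [ e ↦ u ]

    private
      grid-none : ∀ {r u v} → r ≢ none → ∀ g → grid r u v g ≡ none →
        (g ≡ e × u ≡ none) ⊎ (g ≡ f × v ≡ none)
      grid-none r≢none g eq with g Fin.≟ e
      ... | yes g≡e = inj₁ (g≡e , eq)
      ... | no  _ with g Fin.≟ f
      ...   | yes g≡f = inj₂ (g≡f , eq)
      ...   | no  _   = contradiction eq r≢none

      grid-off-f : ∀ {r u v v′} g → g ≢ f → grid r u v g ≡ grid r u v′ g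
      grid-off-f {r} {v = v} {v′} g g≢f with g Fin.≟ e
      ... | yes _ = refl
      ... | no  _ = trans (update-other (λ _ → r) f v g g≢f) (sym (update-other (λ _ → r) f v′ g g≢f))

    module Row (r v : Mode) (r≢none : r ≢ none) (v≢none : v ≢ none) =
      Switching (λ u → grid r u v) e (λ u → update-same ((λ _ → r) [ f ↦ v ]) e u)
        (λ u g g≢e → trans (update-other ((λ _ → r) [ f ↦ v ]) e u g g≢e)
          (sym (update-other ((λ _ → r) [ f ↦ v ]) e none g g≢e)))
        (λ g g≢e eq → Sum.[ g≢e ∘ proj₁ , v≢none ∘ proj₂ ]′ (grid-none r≢none g eq))

    module Column (r u : Mode) (r≢none : r ≢ none) (u≢none : u ≢ none) =
      Switching (λ v → grid r u v) f
        (λ v → trans (update-other ((λ _ → r) [ f ↦ v ]) e u f f≢e) (update-same (λ _ → r) f v))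
        (λ v → grid-off-f)
        (λ g g≢f eq → Sum.[ u≢none ∘ proj₂ , g≢f ∘ proj₁ ]′ (grid-none r≢none g eq))

    -- The separated corners `x` and `y` fix three of the small counts at 1. The sums over
    -- complementary subsets then carry this over to the configurations in which the other ribbons
    -- are present.
    conflict : ∀ {K x y} → # (λ _ → ends) ≡ 1 →
      edge x ≡ f → edge y ≡ f → ¬ x ∼[ grid ends cross ends ] y →
      (∀ p → # (mode ∘ p) + # (mode ∘ not ∘ p) ≡ K) → ⊥
    conflict {K} {x} {y} bouquet x∈f y∈f x≁y constant =
      trios-conflict (0<#orbits τ (turn (grid ends ends sides)) x) (subst (Trio (# (grid ends ends sides)) (# (grid ends sides sides))) F₂₁≡1 (Row.trio ends sides (λ ()) (λ ())))
        (subst (λ k → k + # (grid sides sides sides) ≡ K) F₀₀≡1 (complement false false))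
        (subst (λ k → k + # (grid sides ends sides) ≡ K) F₁₀≡1 (complement true false))
        (complement false true) (complement true true)
        (Row.trio sides ends (λ ()) (λ ())) (Row.trio sides sides (λ ()) (λ ()))
        (Column.trio sides cross (λ ()) (λ ()))
      where
      F₀₀≡1 : # (grid ends ends ends) ≡ 1
      F₀₀≡1 = trans (#-cong all-ends) bouquet
        where
        all-ends : grid ends ends ends ≗ (λ _ → ends)
        all-ends g with g Fin.≟ e | g Fin.≟ f
        ... | yes _ | _     = refl
        ... | no  _ | yes _ = refl
        ... | no  _ | no  _ = refl

      -- With `e` crossed, removing `f` adds a component, so `F₂₀` is one more than `F₂₁`; together
      -- with `F₀₀≡1` this determines `F₁₀` and `F₂₁`.
      top = trio-split (subst (λ k → Trio k (# (grid ends sides ends)) (# (grid ends cross ends))) F₀₀≡1 (Row.trio ends ends (λ ()) (λ ())))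
        (Column.disconnected⇒split ends cross (λ ()) (λ ()) x∈f y∈f x≁y)
        (0<#orbits τ (turn (grid ends cross sides)) x)
      F₁₀≡1 = proj₁ top
      F₂₁≡1 = proj₂ top

      choose : Bool → Bool → Fin n → Bool
      choose u v g = if does (g Fin.≟ e) then u else if does (g Fin.≟ f) then v else false

      -- A subset of the pair `e`, `f` against its complement: every ribbon changes its state.
      complement : ∀ u v →
        # (grid ends (mode u) (mode v)) + # (grid sides (mode (not u)) (mode (not v))) ≡ K
      complement u v = trans (cong₂ _+_ (#-cong chosen) (#-cong unchosen)) (constant (choose u v))
        where
        chosen : grid ends (mode u) (mode v) ≗ mode ∘ choose u v
        chosen g with g Fin.≟ e | g Fin.≟ f
        ... | yes _ | _     = refl
        ... | no  _ | yes _ = refl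
        ... | no  _ | no  _ = refl

        unchosen : grid sides (mode (not u)) (mode (not v)) ≗ mode ∘ not ∘ choose u v
        unchosen g with g Fin.≟ e | g Fin.≟ f
        ... | yes _ | _     = refl
        ... | no  _ | yes _ = refl
        ... | no  _ | no  _ = refl

-- Travelling around a vertex.

module Travel (B : RibbonGraph) where

  private
    F : Set
    F = Flag (|E| B)

    ρⁿ : F → ℕ → F
    ρⁿ = iterate (ρ B)

    τ₀τ₀ : (x : F) → τ₀ (τ₀ x) ≡ x
    τ₀τ₀ = ·-involutive sides

    τ₂τ₂ : (x : F) → τ₂ (τ₂ x) ≡ x
    τ₂τ₂ = ·-involutive ends

    τ₂-fpf : (x : F) → τ₂ x ≢ x
    τ₂-fpf x eq = contradiction (·-free {i = ends} {j = none} {x = x} eq) λ ()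

  open Dihedral (τ₁ B) τ₂ (τ₁-involutive B) τ₂τ₂ τ₂-fpf
  open Matching (τ₁ B) (τ₁-involutive B) (τ₁-fixedPointFree B)

  one-way : ∀ x j k → ρⁿ x j ≢ τ₂ (ρⁿ x k)
  one-way = iterate≢τ-iterate (τ₁-fixedPointFree B)

  ReachesOtherEnd : F → Set
  ReachesOtherEnd x = ∃[ k ] ρⁿ x k ≡ τ₀ x

  -- `IsTwisted` speaks of one corner only. Completing the turn gives the opposite corner along a
  -- side, and travelling in the other direction gives the remaining two.
  twisted⇒reachesOtherEnd : ∀ {e} → IsTwisted B e → ∀ x → edge x ≡ e → ReachesOtherEnd x
  twisted⇒reachesOtherEnd {e} twisted x refl = every x
    where
    change-end : ∀ {x} → ReachesOtherEnd x → ReachesOtherEnd (τ₀ x)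
    change-end {x} (k , eq) =
      let l , eq′ = iterate-reverse (ρ B) step-injective x k eq in l , trans eq′ (sym (τ₀τ₀ x))

    change-side : ∀ {x} → ReachesOtherEnd x → ReachesOtherEnd (τ₂ x)
    change-side {x} (k , eq) = iterate-reverse (ρ B) step-injective (τ₂ (τ₀ x)) k
      (trans (cong (λ y → ρⁿ (τ₂ y) k) (sym eq)) (iterate-τ k x))

    every : ∀ x → ReachesOtherEnd (e , proj₂ x)
    every (_ , none)  = twisted
    every (_ , ends)  = change-side twisted
    every (_ , sides) = change-end twisted
    every (_ , cross) = change-end (change-side twisted)

  -- The other two corners of the ribbon face against the direction of travel.
  next-visit : ∀ {z} → ReachesOtherEnd z → ∀ l → edge (ρⁿ z l) ≡ edge z → ρⁿ z l ≡ z ⊎ ρⁿ z l ≡ τ₀ z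
  next-visit {z} (k , eq) l same with sameEdge z (ρⁿ z l) (sym same)
  ... | none  , back   = inj₁ back
  ... | ends  , across = contradiction across (one-way z l 0)
  ... | sides , far    = inj₂ far
  ... | cross , far    = contradiction (trans far (cong τ₂ (sym eq))) (one-way z l k)

  NoReturn : F → ℕ → Set
  NoReturn x d = ∀ l → 0 < l → l ≤ d → ρⁿ x l ≢ x

  distinct : ∀ {x d j k} → NoReturn x d → j < k → k ≤ d → ρⁿ x j ≢ ρⁿ x k
  distinct {x} {d} {j} {k} noReturn j<k k≤d eq = noReturn (k ∸ j) (m<n⇒0<n∸m j<k) (≤-trans (m∸n≤m k j) k≤d)
    (iterate-injective (ρ B) step-injective j
      (trans (sym (iterate-+ (ρ B) x (k ∸ j) j)) (trans (cong (ρⁿ x) (m∸n+n≡m (<⇒≤ j<k))) (sym eq))))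

  -- Once the twisted loop e is crossed, the arc between its two ends closes up
  -- to a circle of its own.
  module Arc {e : Fin (|E| B)} {z : F} {d : ℕ} (z∈e : edge z ≡ e) (reaches : ReachesOtherEnd z)
    (end∈e : edge (ρⁿ z (suc d)) ≡ e) (noReturn : NoReturn z (suc d))
    (c : Config (|E| B)) (c-e : c e ≡ cross) (c-off : ∀ g → g ≢ e → c g ≡ ends) where

    -- For each `l` these are the two endpoints of one free arc. Together the free arcs lead from
    -- the end of `e` at `z` to its other end, `suc d` steps later.
    OnArc : F → Set
    OnArc y = ∃[ l ] l ≤ d × (y ≡ τ₂ (ρⁿ z l) ⊎ y ≡ ρⁿ z (suc l))

    visit : ∀ l → 0 < l → l ≤ suc d → edge (ρⁿ z l) ≡ e → ρⁿ z l ≡ τ₀ z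
    visit l 0<l l≤ l∈e with next-visit reaches l (trans l∈e (sym z∈e))
    ... | inj₁ back = contradiction back (noReturn l 0<l l≤)
    ... | inj₂ far  = far

    end : ρⁿ z (suc d) ≡ τ₀ z
    end = visit (suc d) (s≤s z≤n) ≤-refl end∈e

    onArc-τ₁ : ∀ {y} → OnArc y → OnArc (τ₁ B y)
    onArc-τ₁ (l , l≤d , inj₁ refl) = l , l≤d , inj₂ (sym (iterate-suc (ρ B) z l))
    onArc-τ₁ (l , l≤d , inj₂ refl) =
      l , l≤d , inj₁ (trans (cong (τ₁ B) (iterate-suc (ρ B) z l)) (τ₁-involutive B _))

    -- Crossing joins the first point `τ₂ z` to the last point `τ₀ z`. No point in between lies on
    -- `e`, since a visit to `e` is at `τ₀ z`, which is reached only at step `suc d`.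
    onArc-cross : ∀ {y} → edge y ≡ e → OnArc y → OnArc (cross · y)
    onArc-cross _ (zero , _ , inj₁ refl) =
      d , ≤-refl , inj₂ (trans (cong τ₀ (τ₂τ₂ z)) (sym end))
    onArc-cross y∈e (suc l , l<d , inj₁ refl) = contradiction
      (trans (visit (suc l) (s≤s z≤n) (m≤n⇒m≤1+n l<d) y∈e) (sym end))
      (distinct noReturn (s≤s l<d) ≤-refl)
    onArc-cross y∈e (l , l≤d , inj₂ refl) = 0 , z≤n , inj₁
      (trans (cong (cross ·_) (visit (suc l) (s≤s z≤n) (s≤s l≤d) y∈e)) (cong τ₂ (τ₀τ₀ z)))

    onArc-ends : ∀ {y} → edge y ≢ e → OnArc y → OnArc (τ₂ y)
    onArc-ends y∉e (zero  , _   , inj₁ refl) = contradiction z∈e y∉e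
    onArc-ends _   (suc l , l<d , inj₁ refl) = l , <⇒≤ l<d , inj₂ (τ₂τ₂ _)
    onArc-ends y∉e (l     , l≤d , inj₂ refl) with l ≟ d
    ... | yes refl = contradiction end∈e y∉e
    ... | no  l≢d  = suc l , ≤∧≢⇒< l≤d l≢d , inj₁ refl

    onArc-turn : ∀ {y} → OnArc y → OnArc (turn c y)
    onArc-turn {y} y∈arc with edge y Fin.≟ e
    ... | yes y∈e = subst (λ i → OnArc (i · y)) (sym (trans (cong c y∈e) c-e)) (onArc-cross y∈e y∈arc)
    ... | no  y∉e = subst (λ i → OnArc (i · y)) (sym (c-off _ y∉e)) (onArc-ends y∉e y∈arc)

    -- The arc is closed under `τ₁` and `turn c`, so no component leaves it.
    separates : ∀ {m w} → 0 < m → m ≤ d →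
      (∀ l → 0 < l → l ≤ suc d → w ≢ ρⁿ z l) → (∀ l → w ≢ τ₂ (ρⁿ z l)) → ¬ ρⁿ z m ∼[ c ] w
    separates {suc m} _ m<d off-arc off-arc′ connected
      with SameOrbit-closed OnArc (τ₁-involutive B) (turn-involutive c) onArc-τ₁ onArc-turn connected
             (m , <⇒≤ m<d , inj₂ refl)
    ... | l , l≤d , inj₁ eq = off-arc′ l eq
    ... | l , l≤d , inj₂ eq = off-arc (suc l) (s≤s z≤n) (s≤s l≤d) eq

  module _ {e f : Fin (|E| B)} (twisted : IsTwisted B e)
    (c : Config (|E| B)) (c-e : c e ≡ cross) (c-off : ∀ g → g ≢ e → c g ≡ ends) where

    Separated : Set
    Separated = ∃[ x ] ∃[ y ] edge x ≡ f × edge y ≡ f × ¬ x ∼[ c ] y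

    -- The arc runs from step 0 to step `suc j`; `f` is met on it at step `i` and beyond it at step
    -- `k`.
    interlaced⇒separated : Interlaced B e f → Separated
    interlaced⇒separated (x , i , suc j , k , (0<i , s≤s i≤j , j<k) , noReturn , x∈e , i∈f , j∈e , k∈f) =
      ρⁿ x i , ρⁿ x k , i∈f , k∈f , Arc.separates x∈e (twisted⇒reachesOtherEnd twisted x x∈e) j∈e
        (λ l 0<l l≤j → noReturn l 0<l (≤-trans l≤j (<⇒≤ j<k))) c c-e c-off 0<i i≤j
        (λ l _ l≤j eq → distinct noReturn (≤-<-trans l≤j j<k) ≤-refl (sym eq))
        (λ l → one-way x k l)

    -- Now the arc runs from step `i` to step `k`; `f` is met on it at step `j`, which is `suc p`
    -- steps after `z`, and before it at `x`.
    interlaced⇒separated′ : Interlaced B f e → Separated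
    interlaced⇒separated′ (x , i , j , k , (0<i , i<j , j<k) , noReturn , x∈f , i∈e , j∈f , k∈e)
      with p , refl ← m≤n⇒∃[o]m+o≡n i<j | d , refl ← m≤n⇒∃[o]m+o≡n (<-trans i<j j<k) =
      ρⁿ z (suc p) , x , trans (cong edge (later p)) j∈f , x∈f ,
      Arc.separates i∈e (twisted⇒reachesOtherEnd twisted z i∈e) (trans (cong edge (later d)) k∈e)
        noReturn′ c c-e c-off (s≤s z≤n) (+-cancelˡ-< i _ _ (s≤s⁻¹ j<k))
        (λ l 0<l l≤d eq → noReturn (i + l) (≤-trans 0<i (m≤m+n i l)) (within l≤d) (sym (trans eq (shift l))))
        (λ l eq → one-way x 0 (i + l) (trans eq (cong τ₂ (shift l))))
      where
      z : F
      z = ρⁿ x i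

      shift : ∀ l → ρⁿ z l ≡ ρⁿ x (i + l)
      shift l = sym (iterate-+ (ρ B) x i l)

      later : ∀ l → ρⁿ z (suc l) ≡ ρⁿ x (suc i + l)
      later l = trans (shift (suc l)) (cong (ρⁿ x) (+-suc i l))

      within : ∀ {l} → l ≤ suc d → i + l ≤ suc i + d
      within {l} l≤d = subst (i + l ≤_) (+-suc i d) (+-monoʳ-≤ i l≤d)

      noReturn′ : NoReturn z (suc d)
      noReturn′ l 0<l l≤d eq = distinct noReturn (m<m+n i 0<l) (within l≤d) (sym (trans (sym (shift l)) eq))

-- Subsets and sums of monomials.

∈-subsets : (A : Subset n) → A ∈ subsets n
∈-subsets Vec.[]            = here refl
∈-subsets (false Vec.∷ A) = ∈-++⁺ˡ (∈-map⁺ _ (∈-subsets A))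
∈-subsets {suc n} (true Vec.∷ A)  = ∈-++⁺ʳ (map (false Vec.∷_) (subsets n)) (∈-map⁺ _ (∈-subsets A))

length-subsets : ∀ n → length (subsets n) ≡ 2 ^ n
length-subsets zero    = refl
length-subsets (suc n) = begin
  length (map (false Vec.∷_) (subsets n) ++ map (true Vec.∷_) (subsets n))
    ≡⟨ length-++ (map (false Vec.∷_) (subsets n)) ⟩
  length (map (false Vec.∷_) (subsets n)) + length (map (true Vec.∷_) (subsets n))
    ≡⟨ cong₂ _+_ (length-map _ (subsets n)) (length-map _ (subsets n)) ⟩
  length (subsets n) + length (subsets n)
    ≡⟨ cong₂ _+_ (length-subsets n) (trans (length-subsets n) (sym (+-identityʳ _))) ⟩
  2 ^ suc n ∎
  where open ≡-Reasoning

module _ {A : Set} (f : A → ℕ) (f≤1 : ∀ x → f x ≤ 1) where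

  sum≤length : ∀ xs → sum (map f xs) ≤ length xs
  sum≤length []       = z≤n
  sum≤length (x ∷ xs) = +-mono-≤ (f≤1 x) (sum≤length xs)

  -- If one term were 0, the others, being at most 1, could not make up for it.
  sum≡length⇒1 : ∀ {xs} → sum (map f xs) ≡ length xs → ∀ {x} → x ∈ xs → f x ≡ 1
  sum≡length⇒1 {x ∷ xs} total x∈ with f x in fx | f≤1 x
  ... | 0 | _ = contradiction (subst (_≤ length xs) total (sum≤length xs)) (<-irrefl refl)
  sum≡length⇒1 {x ∷ xs} total (here refl) | 1 | _ = fx
  sum≡length⇒1 {x ∷ xs} total (there x∈)  | 1 | _ = sum≡length⇒1 (suc-injective total) x∈
  sum≡length⇒1 total x∈ | suc (suc _) | s≤s ()

·z^-diagonal : ∀ c k → (c ·z^ k) k ≡ c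
·z^-diagonal c k with k ℤ.≟ k
... | yes _  = refl
... | no k≢k = contradiction refl k≢k

·z^≤ : ∀ c k i → (c ·z^ k) i ≤ c
·z^≤ c k i with i ℤ.≟ k
... | yes _ = ≤-refl
... | no  _ = z≤n

·z^≡1 : ∀ k i → (1 ·z^ k) i ≡ 1 → k ≡ i
·z^≡1 k i eq with i ℤ.≟ k
... | yes i≡k = sym i≡k

∑-monomial : ∀ {A : Set} (f : A → ℤ) k → (∀ x → f x ≡ k) → ∀ xs →
  ∑ (map (λ x → 1 ·z^ f x) xs) ≗ length xs ·z^ k
∑-monomial f k f≡k [] i with i ℤ.≟ k
... | yes _ = refl
... | no  _ = refl
∑-monomial f k f≡k (x ∷ xs) i with ∑-monomial f k f≡k xs i | f x | f≡k x
... | ih | _ | refl with i ℤ.≟ k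
...   | yes _ = cong suc ih
...   | no  _ = ih

-- Each monomial contributes at most 1 to the coefficient at `k`, so all of them must have exponent
-- `k`.
∑-monomial⁻ : ∀ {A : Set} (f : A → ℤ) k {xs} → ∑ (map (λ x → 1 ·z^ f x) xs) k ≡ length xs →
  ∀ {x} → x ∈ xs → f x ≡ k
∑-monomial⁻ f k {xs} total {x} x∈ = ·z^≡1 (f x) k
  (sum≡length⇒1 (λ x → (1 ·z^ f x) k) (λ x → ·z^≤ 1 (f x) k) (trans (cong sum (map-∘ xs)) total) x∈)

-- Partial duals and boundary components.

module _ (B : RibbonGraph) where

  monomial⇒constant : ∀ {k} → ∂ε B ≗ (2 ^ |E| B) ·z^ k → ∀ A → eulerGenus (partialDual B A) ≡ k
  monomial⇒constant {k} eq A = ∑-monomial⁻ (eulerGenus ∘ partialDual B) k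
    (trans (eq k) (trans (·z^-diagonal (2 ^ |E| B) k) (sym (length-subsets (|E| B))))) (∈-subsets A)

  constant⇒monomial : ∀ {k} → (∀ A → eulerGenus (partialDual B A) ≡ k) → ∂ε B ≗ (2 ^ |E| B) ·z^ k
  constant⇒monomial {k} constant i = trans (∑-monomial _ k constant (subsets (|E| B)) i)
    (cong (λ c → (c ·z^ k) i) (length-subsets (|E| B)))

  open Matching (τ₁ B) (τ₁-involutive B) (τ₁-fixedPointFree B)

  -- Conjugation by `exchange A` brings `τ₁` of the dual back to that of `B`; its `τ₂` then follows
  -- the sides of the ribbons in `A` and the ends of the others.
  exchange-τ₂ : ∀ A (x : Flag (|E| B)) → exchange A (τ₂ x) ≡ turn (mode ∘ Vec.lookup A) (exchange A x)
  exchange-τ₂ A (e , h , s) with Vec.lookup A e in eq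
  ... | true  rewrite eq = refl
  ... | false rewrite eq = refl

  exchange-τ₀ : ∀ A (x : Flag (|E| B)) → exchange A (τ₀ x) ≡ turn (mode ∘ not ∘ Vec.lookup A) (exchange A x)
  exchange-τ₀ A (e , h , s) with Vec.lookup A e in eq
  ... | true  rewrite eq = refl
  ... | false rewrite eq = refl

  |V|-partialDual : ∀ A → |V| (partialDual B A) ≡ #isolatedVertices B + # (mode ∘ Vec.lookup A)
  |V|-partialDual A = cong (λ k → #isolatedVertices B + k)
    (#orbits-conj _ τ₂ (τ₁ B) _ (exchange A) (exchange A) (exchange-involutive A) (exchange-involutive A)
      (λ x → exchange-involutive A _) (exchange-τ₂ A))

  -- Here `τ₀` takes the place of `τ₂`, and conjugation turns it into the turn for the complement of
  -- `A`.
  |F|-partialDual : ∀ A → |F| (partialDual B A) ≡ #isolatedVertices B + # (mode ∘ not ∘ Vec.lookup A)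
  |F|-partialDual A = cong (λ k → #isolatedVertices B + k)
    (trans (#orbits-swap τ₀ (τ₁ (partialDual B A)))
      (#orbits-conj _ τ₀ (τ₁ B) _ (exchange A) (exchange A) (exchange-involutive A) (exchange-involutive A)
        (λ x → exchange-involutive A _) (exchange-τ₀ A)))

-- Partial duality keeps the number of edges, so equal Euler genus means equal v + f.
euler-injective : ∀ n {v v′ f f′} →
  + 2 ℤ.- (+ v ℤ.- + n ℤ.+ + f) ≡ + 2 ℤ.- (+ v′ ℤ.- + n ℤ.+ + f′) → v + f ≡ v′ + f′
euler-injective n {v} {v′} {f} {f′} eq = ℤ.+-injective (ℤ.neg-injective
  (∙-cancelˡ (+ 2 ℤ.+ + n) _ _ (trans (sym (collect v f)) (trans eq (collect v′ f′)))))
  where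
  rearrange : ∀ n v f → + 2 ℤ.- (v ℤ.- n ℤ.+ f) ≡ (+ 2 ℤ.+ n) ℤ.+ (ℤ.- (v ℤ.+ f))
  rearrange = ℤ.solve-∀

  collect : ∀ v f → + 2 ℤ.- (+ v ℤ.- + n ℤ.+ + f) ≡ (+ 2 ℤ.+ + n) ℤ.+ (ℤ.- (+ (v + f)))
  collect v f = rearrange (+ n) (+ v) (+ f)

-- Partial duals of the bouquet with one twisted loop.

module _ {B : RibbonGraph} (B≅B₁̄ : B ≅ B₁̄) where
  open _≅_ B≅B₁̄
  open Inverse bijection using (to; from; strictlyInverseˡ; strictlyInverseʳ)
  open Matching (τ₁ B) (τ₁-involutive B) (τ₁-fixedPointFree B)

  private
    e₀ : Fin (|E| B)
    e₀ = edge (from (Fin.zero , none))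

    to-mode : ∀ i x → to (i · x) ≡ i · to x
    to-mode none  x = refl
    to-mode ends  x = to-τ₂ x
    to-mode sides x = to-τ₀ x
    to-mode cross x = trans (to-τ₀ (τ₂ x)) (cong τ₀ (to-τ₂ x))

    to-injective : ∀ {x y} → to x ≡ to y → x ≡ y
    to-injective eq = trans (sym (strictlyInverseʳ _)) (trans (cong from eq) (strictlyInverseʳ _))

    -- In `B₁̄` any two flags differ by a mode, and `to` commutes with the action of modes.
    one-edge : ∀ e → e ≡ e₀
    one-edge e with to (e₀ , none) in eq | to (e , none) in eq′
    ... | Fin.zero , x | Fin.zero , y with i , far ← sameEdge (Fin.zero , x) (Fin.zero , y) refl =
      cong edge (to-injective {e , none} {i · (e₀ , none)}
        (trans eq′ (trans far (trans (cong (i ·_) (sym eq)) (sym (to-mode i _))))))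

    #≡1 : ∀ p → # (mode ∘ p) ≡ 1
    #≡1 p = trans (#orbits-conj (τ₁ B) (turn (mode ∘ p)) (τ₁ B₁̄) (turn (λ _ → mode (p e₀)))
      to from strictlyInverseˡ strictlyInverseʳ to-τ₁
      (λ x → trans (to-mode (mode (p (edge x))) x) (cong (λ e → mode (p e) · to x) (one-edge (edge x)))))
      (constant (p e₀))
      where
      -- The only loop of `B₁̄` is present or absent, and both counts are found by evaluation.
      constant : ∀ b → #orbits (τ₁ B₁̄) (turn (λ _ → mode b)) ≡ 1
      constant true  = refl
      constant false = refl

    |E|≡1 : |E| B ≡ 1
    |E|≡1 = unique (|E| B) e₀ one-edge
      where
      unique : ∀ n (e : Fin n) → (∀ f → f ≡ e) → n ≡ 1
      unique 1 e all = refl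
      unique (suc (suc n)) e all with () ← trans (all Fin.zero) (sym (all (Fin.suc Fin.zero)))

  eulerGenus≡1 : ∀ A → eulerGenus (partialDual B A) ≡ + 1
  eulerGenus≡1 A = euler
    (trans (|V|-partialDual B A) (cong₂ _+_ isolated (#≡1 (Vec.lookup A))))
    |E|≡1
    (trans (|F|-partialDual B A) (cong₂ _+_ isolated (#≡1 (not ∘ Vec.lookup A))))
    where
    euler : ∀ {v n f} → v ≡ 1 → n ≡ 1 → f ≡ 1 → + 2 ℤ.- (+ v ℤ.- + n ℤ.+ + f) ≡ + 1
    euler refl refl refl = refl

-- Neighbours of a twisted loop, and the conclusion.

module _ (B : RibbonGraph) (bouquet : IsBouquet B) {e : Fin (|E| B)} (twisted : IsTwisted B e) where
  open Matching (τ₁ B) (τ₁-involutive B) (τ₁-fixedPointFree B)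
  open Travel B

  private
    -- The vertex that carries `e` is the only one.
    no-isolated×one-circle : #isolatedVertices B ≡ 0 × # (λ _ → ends) ≡ 1
    no-isolated×one-circle = split (#isolatedVertices B) bouquet (0<#orbits (τ₁ B) τ₂ (e , none))
      where
      split : ∀ k {l} → k + l ≡ 1 → 0 < l → k ≡ 0 × l ≡ 1
      split zero    eq 0<l = refl , eq
      split (suc k) eq 0<l = contradiction (m+n≡0⇒n≡0 k (suc-injective eq)) (>⇒≢ 0<l)

  single-edge⇒≅B₁̄ : (∀ f → f ≡ e) → B ≅ B₁̄
  single-edge⇒≅B₁̄ all = record
    { bijection = mk↔ₛ′ (λ x → Fin.zero , proj₂ x) (λ x → e , proj₂ x)
        (λ { (Fin.zero , _) → refl ; (Fin.suc () , _) }) (λ { (f , x) → cong (_, x) (sym (all f)) })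
    ; to-τ₀    = λ _ → refl
    ; to-τ₁    = λ x → cong (λ y → Fin.zero , proj₂ y) (τ₁≗cross x)
    ; to-τ₂    = λ _ → refl
    ; isolated = proj₁ no-isolated×one-circle
    }
    where
    τ₁≗cross : ∀ x → τ₁ B x ≡ cross · x
    τ₁≗cross x with reaches@(k , far) ← twisted⇒reachesOtherEnd twisted (τ₂ x) (all _)
      -- The first step from `τ₂ x` leads to `τ₁ x`. If it led back to `τ₂ x`, the travel would
      -- never reach the other end.
      with next-visit {τ₂ x} reaches 1 (trans (all _) (sym (all _)))
    ... | inj₂ next = trans (cong (τ₁ B) (sym (·-involutive ends x))) next
    ... | inj₁ stay = contradiction (trans (sym far) (stuck k)) λ eq →
      contradiction (·-free {i = sides} {j = none} {x = τ₂ x} eq) λ ()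
      where
      stuck : ∀ k → iterate (ρ B) (τ₂ x) k ≡ τ₂ x
      stuck zero    = refl
      stuck (suc k) = trans (cong (λ y → iterate (ρ B) y k) stay) (stuck k)

  -- Interlacement in either order separates two corners of `f` once `e` is crossed, which a
  -- constant v + f excludes.
  constant⇒no-neighbour : ∀ {b} → (∀ A → eulerGenus (partialDual B A) ≡ + b) →
    ∀ {f} → f ≢ e → Interlaced B e f ⊎ Interlaced B f e → ⊥
  constant⇒no-neighbour {b} genus {f} f≢e interlaced =
    let x , y , x∈f , y∈f , x≁y = Sum.[ interlaced⇒separated {f = f} twisted c c-e c-off ,
                                        interlaced⇒separated′ {f = f} twisted c c-e c-off ]′ interlaced
    in Grid.conflict (τ₁ B) (τ₁-involutive B) (τ₁-fixedPointFree B) f≢e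
         (proj₂ no-isolated×one-circle) x∈f y∈f x≁y constant
    where
    c : Config (|E| B)
    c = Grid.grid (τ₁ B) (τ₁-involutive B) (τ₁-fixedPointFree B) f≢e ends cross ends

    c-e : c e ≡ cross
    c-e = update-same ((λ _ → ends) [ f ↦ ends ]) e cross

    c-off : ∀ g → g ≢ e → c g ≡ ends
    c-off g g≢e with g Fin.≟ e | g Fin.≟ f
    ... | yes g≡e | _     = contradiction g≡e g≢e
    ... | no _    | yes _ = refl
    ... | no _    | no _  = refl

    pair : (Fin (|E| B) → Bool) → ℕ
    pair p = # (mode ∘ p) + # (mode ∘ not ∘ p)

    |V|+|F| : ∀ p → |V| (partialDual B (Vec.tabulate p)) + |F| (partialDual B (Vec.tabulate p)) ≡ pair p
    |V|+|F| p = cong₂ _+_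
      (trans (|V|-partialDual B (Vec.tabulate p)) (cong₂ _+_ (proj₁ no-isolated×one-circle)
        (#-cong (λ g → cong mode (lookup∘tabulate p g)))))
      (trans (|F|-partialDual B (Vec.tabulate p)) (cong₂ _+_ (proj₁ no-isolated×one-circle)
        (#-cong (λ g → cong (mode ∘ not) (lookup∘tabulate p g)))))

    constant : ∀ p → pair p ≡ pair (λ _ → false)
    constant p = trans (sym (|V|+|F| p)) (trans
      (euler-injective (|E| B) (trans (genus (Vec.tabulate p)) (sym (genus (Vec.tabulate (λ _ → false))))))
      (|V|+|F| (λ _ → false)))

  -- The first edge of a path from `e` in the intersection graph would lead to a neighbour of `e`,
  -- so every such path is empty.
  constant⇒single-edge : IsPrime B → ∀ {b} → (∀ A → eulerGenus (partialDual B A) ≡ + b) → ∀ f → f ≡ e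
  constant⇒single-edge prime genus f with prime e f
  ... | ε = refl
  ... | fwd (e≢g , interlaced) ◅ _ =
    ⊥-elim (constant⇒no-neighbour genus (≢-sym e≢g) (inj₁ interlaced))
  ... | bwd (g≢e , interlaced) ◅ _ =
    ⊥-elim (constant⇒no-neighbour genus g≢e (inj₂ interlaced))

theorem26 : (B : RibbonGraph) → IsBouquet B → IsPrime B → IsNonOrientable B →
    (∃[ b ] ∂ε B ≗ (2 ^ |E| B) ·z^ (+ b)) ⇔ (B ≅ B₁̄)
theorem26 B bouquet prime (e , twisted) = mk⇔
  (λ (b , monomial) → single-edge⇒≅B₁̄ B bouquet twisted
    (constant⇒single-edge B bouquet twisted prime (monomial⇒constant B monomial)))
  -- Every partial dual has one vertex, one edge and one boundary component, and 2 - (1 - 1 + 1) =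
  -- 1.
  (λ B≅B₁̄ → 1 , constant⇒monomial B (eulerGenus≡1 B≅B₁̄))
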